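{- Let $n\ge 2$ be an integer. Then $\gamma^{SLD}(P_n\square P_2)=n+1$ if $n$ is odd and $\gamma^{SLD}(P_n\square P_2)=n+2$ if $n$ is even.
   Context: $P_k$ denotes the path on $k$ vertices. The Cartesian product $G\square H$ has vertex set $V(G)\times V(H)$, with $(u,v)$ adjacent to $(u',v')$ iff either $u=u'$ and $vv'\in E(H)$, or $uu'\in E(G)$ and $v=v'$. For a vertex $u$, $N[u]$ is its closed neighbourhood. A code is a non-empty subset $C$ of the vertex set $V$; $I(C;u)=N[u]\cap C$. A code $C$ is self-locating-dominating if for every $u\in V\setminus C$ we have $I(C;u)\neq\emptyset$ and $\bigcap_{c\in I(C;u)}N[c]=\{u\}$; $\gamma^{SLD}$ is the minimum size of such a code. -}

module Defs where

open import Data.Bool.Base using (Bool; T)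
open import Data.Fin.Base using (Fin; toℕ)
open import Data.List.Base using (List; length; filterᵇ; allFin; cartesianProduct)
open import Data.List.Membership.Propositional using () renaming (_∈_ to _∈ˡ_)
open import Data.List.Membership.Propositional.Properties
  using (∈-allFin; ∈-cartesianProduct⁺)
open import Data.List.Relation.Unary.Unique.Propositional using (Unique)
open import Data.List.Relation.Unary.Unique.Propositional.Properties
  using (allFin⁺; cartesianProduct⁺)
open import Data.Nat.Base using (ℕ; suc; _≤_)
open import Data.Nat.Properties using (1+n≢n)
open import Data.Product.Base using (_×_; _,_; proj₁; ∃; ∃-syntax)
open import Data.Sum.Base using (_⊎_; inj₁; inj₂; swap)
open import Function.Base using (_∘_)
open import Level using (0ℓ)
open import Relation.Binary.Core using (Rel)
open import Relation.Binary.Definitions using (Symmetric; Irreflexive)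
open import Relation.Binary.PropositionalEquality using (_≡_; refl; sym)
open import Relation.Unary using (Pred; _∈_; _∉_; _∩_; _≐_; ｛_｝; Satisfiable; ⋂)

-- The vertex set is finite: it comes with a duplicate-free, exhaustive
-- enumeration, which is used only to count the elements of subsets.
record FiniteSimpleGraph : Set₁ where
  field
    V        : Set
    Adj      : Rel V 0ℓ
    adj-sym  : Symmetric Adj
    adj-irr  : Irreflexive _≡_ Adj
    vertices : List V
    unique   : Unique vertices
    complete : ∀ v → v ∈ˡ vertices

P : ℕ → FiniteSimpleGraph
P k = record
  { V        = Fin k
  ; Adj      = λ i j → suc (toℕ i) ≡ toℕ j ⊎ suc (toℕ j) ≡ toℕ i
  ; adj-sym  = swap
  ; adj-irr  = λ { refl (inj₁ e) → 1+n≢n e ; refl (inj₂ e) → 1+n≢n e }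
  ; vertices = allFin k
  ; unique   = allFin⁺ k
  ; complete = ∈-allFin
  }

infixl 6 _□_

_□_ : FiniteSimpleGraph → FiniteSimpleGraph → FiniteSimpleGraph
G □ H = record
  { V        = G.V × H.V
  ; Adj      = λ (u , v) (u′ , v′) →
                 (u ≡ u′ × H.Adj v v′) ⊎ (G.Adj u u′ × v ≡ v′)
  ; adj-sym  = λ { (inj₁ (e , a)) → inj₁ (sym e , H.adj-sym a)
                 ; (inj₂ (a , e)) → inj₂ (G.adj-sym a , sym e) }
  ; adj-irr  = λ { refl (inj₁ (_ , a)) → H.adj-irr refl a
                 ; refl (inj₂ (a , _)) → G.adj-irr refl a }
  ; vertices = cartesianProduct G.vertices H.vertices
  ; unique   = cartesianProduct⁺ G.unique H.unique
  ; complete = λ (u , v) → ∈-cartesianProduct⁺ (G.complete u) (H.complete v)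
  }
  where
  module G = FiniteSimpleGraph G
  module H = FiniteSimpleGraph H

module _ (G : FiniteSimpleGraph) where
  open FiniteSimpleGraph G

  N[_] : V → Pred V 0ℓ
  N[ u ] v = u ≡ v ⊎ Adj u v

  -- Subsets of the finite set V are given by characteristic functions.
  VertexSubset : Set
  VertexSubset = V → Bool

  ⟦_⟧ : VertexSubset → Pred V 0ℓ
  ⟦ C ⟧ = T ∘ C

  size : VertexSubset → ℕ
  size C = length (filterᵇ C vertices)

  IsCode : VertexSubset → Set
  IsCode C = Satisfiable ⟦ C ⟧

  I : VertexSubset → V → Pred V 0ℓ
  I C u = N[ u ] ∩ ⟦ C ⟧

  IsSelfLocatingDominating : VertexSubset → Set
  IsSelfLocatingDominating C =
    IsCode C ×
    (∀ u → u ∉ ⟦ C ⟧ →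
      Satisfiable (I C u) ×
      (⋂ (∃ (I C u)) (λ c → N[ proj₁ c ]) ≐ ｛ u ｝))

-- "γ^SLD(G) = k".  A relation rather than a function of G, because the
-- graph without vertices has no code and hence no minimum.
infix 4 γˢˡᵈ[_]≡_

γˢˡᵈ[_]≡_ : FiniteSimpleGraph → ℕ → Set
γˢˡᵈ[ G ]≡ k =
  (∃[ C ] IsSelfLocatingDominating G C × size G C ≡ k) ×
  (∀ C → IsSelfLocatingDominating G C → k ≤ size G C)

{-# OPTIONS --safe #-}

-- A vertex u outside a self-locating-dominating code C of the ladder must have
-- both of its horizontal neighbours in C: if one of them is missing from C,
-- then a vertex of the other row, diagonal to u on the side away from the
-- missing one, lies in N[c] for every c ∈ I(C;u).  Conversely, the closed
-- neighbourhoods of the two horizontal neighbours of u meet only in u.  So each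
-- row of C starts and ends with a codeword and has no two consecutive non-
-- codewords, which forces at least 1 + ⌊n/2⌋ codewords per row; alternating
-- rows attain this.

module Submission where

open import Defs
open import Data.Bool.Base using (Bool; true; false; T; if_then_else_)
open import Data.Bool.Properties using (T?)
open import Data.Empty using (⊥-elim)
open import Data.Fin.Base using (Fin; zero; suc; toℕ; inject₁; opposite)
open import Data.Fin.Properties using (toℕ-inject₁; toℕ-injective; any?)
open import Data.List.Base using (length; filterᵇ; allFin; tabulate; cartesianProduct)
open import Data.Nat.Base using (ℕ; zero; suc; _+_; _≤_; z≤n; s≤s; ⌊_/2⌋)
open import Data.Nat.Divisibility using (_∣_; _∤_; _∣0; ∣-refl; ∣1⇒≡1; ∣m+n∣m⇒∣n; ∣m∣n⇒∣m+n)
open import Data.Nat.Properties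
  using (_≟_; ≤-refl; ≤-reflexive; ≤-trans; n≤1+n; <-irrefl; m≤n+m; 1+n≢n;
         suc-injective; +-mono-≤; +-suc; ⌊n/2⌋-mono)
open import Data.Product.Base using (_×_; _,_; proj₁; proj₂; ∃-syntax)
open import Data.Product.Properties using (,-injectiveˡ)
open import Data.Sum.Base using (_⊎_; inj₁; inj₂)
open import Data.Unit.Base using (tt)
open import Function.Base using (_∘_; id)
open import Relation.Binary.PropositionalEquality
  using (_≡_; _≢_; refl; sym; trans; cong; cong₂; subst)
open import Relation.Nullary.Decidable.Core using (yes; no; _×-dec_; decidable-stable)
open import Relation.Nullary.Negation.Core using (¬_; contradiction)

open FiniteSimpleGraph using (Adj; adj-sym)

Ladder : ℕ → FiniteSimpleGraph
Ladder n = P n □ P 2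

-- Counting codewords row by row

weight : ∀ {n} → (Fin n → Bool) → ℕ
weight {zero}  f = 0
weight {suc n} f = (if f zero then 1 else 0) + weight (f ∘ suc)

row : ∀ {n} → VertexSubset (Ladder n) → Fin 2 → Fin n → Bool
row C r i = C (i , r)

size≡weights : ∀ {n} (C : VertexSubset (Ladder n)) →
  size (Ladder n) C ≡ weight (row C zero) + weight (row C (suc zero))
size≡weights {n} C = go id
  where
  -- An arbitrary `g` is needed for the induction: the tail of `tabulate g` is `tabulate (g ∘ suc)`.
  go : ∀ {m} (g : Fin m → Fin n) →
    length (filterᵇ C (cartesianProduct (tabulate g) (allFin 2))) ≡
    weight (row C zero ∘ g) + weight (row C (suc zero) ∘ g)
  go {zero}  g = refl
  go {suc m} g with C (g zero , zero)
  go {suc m} g | true  with C (g zero , suc zero)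
  ... | true  = cong suc (trans (cong suc (go (g ∘ suc))) (sym (+-suc _ _)))
  ... | false = cong suc (go (g ∘ suc))
  go {suc m} g | false with C (g zero , suc zero)
  ... | true  = trans (cong suc (go (g ∘ suc))) (sym (+-suc _ _))
  ... | false = go (g ∘ suc)

-- This also makes the last position a codeword, since no `k` lies to its right.
GuardedRight : ∀ {n} → (Fin n → Bool) → Set
GuardedRight f = ∀ i → ¬ T (f i) → ∃[ k ] suc (toℕ i) ≡ toℕ k × T (f k)

GuardedLeft : ∀ {n} → (Fin n → Bool) → Set
GuardedLeft f = ∀ i → ¬ T (f i) → ∃[ j ] suc (toℕ j) ≡ toℕ i × T (f j)

guardedRight-tail : ∀ {n} {f : Fin (suc n) → Bool} →
  GuardedRight f → GuardedRight (f ∘ suc)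
guardedRight-tail g i i∉f with g (suc i) i∉f
... | suc k , e , k∈f = k , suc-injective e , k∈f

weight-codeword : ∀ {n} (f : Fin (suc n) → Bool) → T (f zero) →
  suc (weight (f ∘ suc)) ≤ weight f
weight-codeword f 0∈f with true ← f zero = ≤-refl

weight-tail : ∀ {n} (f : Fin (suc n) → Bool) → weight (f ∘ suc) ≤ weight f
weight-tail f = m≤n+m _ (if f zero then 1 else 0)

-- Induction keeping a codeword in front: position 0 is removed if position 1 is a codeword, and
-- positions 0 and 1 are removed otherwise.
weight-bound : ∀ n (f : Fin (suc n) → Bool) →
  T (f zero) → GuardedRight f → suc ⌊ suc n /2⌋ ≤ weight f
weight-bound zero f 0∈f g = ≤-trans (s≤s z≤n) (weight-codeword f 0∈f)
weight-bound (suc n) f 0∈f g with T? (f (suc zero))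
... | yes 1∈f = ≤-trans
  (s≤s (≤-trans (⌊n/2⌋-mono (n≤1+n (suc (suc n))))
         (weight-bound n (f ∘ suc) 1∈f (guardedRight-tail g))))
  (weight-codeword f 0∈f)
... | no 1∉f with g (suc zero) 1∉f
-- The guard of position 1 can only be position 2, so a row of two positions cannot occur here.
weight-bound (suc (suc n)) f 0∈f g | no 1∉f | suc (suc zero) , refl , 2∈f = ≤-trans
  (s≤s (≤-trans (weight-bound n (λ i → f (suc (suc i))) 2∈f
                  (guardedRight-tail (guardedRight-tail g)))
         (weight-tail (f ∘ suc))))
  (weight-codeword f 0∈f)

-- Rows of a self-locating-dominating code

opposite-adj : ∀ r → Adj (P 2) r (opposite r)
opposite-adj zero       = inj₁ refl
opposite-adj (suc zero) = inj₂ refl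

adj⇒opposite : ∀ {r s} → Adj (P 2) r s → opposite r ≡ s
adj⇒opposite {zero}     {zero}     (inj₁ ())
adj⇒opposite {zero}     {zero}     (inj₂ ())
adj⇒opposite {zero}     {suc zero} _ = refl
adj⇒opposite {suc zero} {zero}     _ = refl
adj⇒opposite {suc zero} {suc zero} (inj₁ ())
adj⇒opposite {suc zero} {suc zero} (inj₂ ())

module _ {n} {C : VertexSubset (Ladder n)}
         (sld : IsSelfLocatingDominating (Ladder n) C) where

  -- Since `u` is not a codeword, I(C;u) contains only proper neighbours of `u`, and `w` lies in the
  -- intersection that equals {u}.
  located : ∀ {u w} → ¬ T (C u) →
    (∀ c → Adj (Ladder n) u c → T (C c) → N[_] (Ladder n) c w) → u ≡ w
  located {u} u∉C covers = proj₁ (proj₂ (proj₂ sld u u∉C)) λ where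
    (c , inj₁ refl , c∈C) → contradiction c∈C u∉C
    (c , inj₂ uc   , c∈C) → covers c uc c∈C

  -- Every codeword adjacent to (i , r) is either (i , opposite r) or (j , r),
  -- and both of these are adjacent to the diagonal vertex (j , opposite r).
  ¬only-neighbour : ∀ {i j} r → ¬ T (C (i , r)) → i ≢ j → Adj (P n) i j →
    ¬ (∀ k → Adj (P n) i k → T (C (k , r)) → k ≡ j)
  ¬only-neighbour {i} {j} r i∉C i≢j ij only =
    i≢j (,-injectiveˡ (located i∉C λ where
      (_ , s) (inj₁ (refl , rs)) _ → inj₂ (inj₂ (ij , sym (adj⇒opposite rs)))
      (k , _) (inj₂ (ik , refl)) k∈C →
        inj₂ (inj₁ (only k ik k∈C , opposite-adj r))))

-- Column 1, which exists as there are at least two columns, is the only horizontal neighbour of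
-- column 0.
row-start : ∀ {n} {C : VertexSubset (Ladder (suc (suc n)))} →
  IsSelfLocatingDominating (Ladder (suc (suc n))) C → ∀ r → T (row C r zero)
row-start {C = C} sld r = decidable-stable (T? (C (zero , r))) λ 0∉C →
  ¬only-neighbour sld r 0∉C (λ ()) (inj₁ refl) λ where
    (suc zero) (inj₁ refl) _ → refl
    k          (inj₂ ())

row-guardedRight : ∀ {n} {C : VertexSubset (Ladder (suc (suc n)))} →
  IsSelfLocatingDominating (Ladder (suc (suc n))) C → ∀ r → GuardedRight (row C r)
row-guardedRight sld r zero 0∉C = contradiction (row-start sld r) 0∉C
row-guardedRight {C = C} sld r (suc i) i∉C
  with any? (λ k → (suc (suc (toℕ i)) ≟ toℕ k) ×-dec T? (C (k , r)))
... | yes right = right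
-- With no codeword on the right, the left neighbour `inject₁ i` is the only possible horizontal
-- one.
... | no ¬right = ⊥-elim (¬only-neighbour sld r i∉C i+1≢i
                            (inj₂ (cong suc (toℕ-inject₁ i))) λ where
    k (inj₁ e) k∈C → contradiction (k , e , k∈C) ¬right
    k (inj₂ e) _   → toℕ-injective (trans (suc-injective e) (sym (toℕ-inject₁ i))))
  where
  i+1≢i : suc i ≢ inject₁ i
  i+1≢i e = 1+n≢n (trans (cong toℕ e) (toℕ-inject₁ i))

size-bound : ∀ {n} → 2 ≤ n → ∀ C → IsSelfLocatingDominating (Ladder n) C →
  suc ⌊ n /2⌋ + suc ⌊ n /2⌋ ≤ size (Ladder n) C
size-bound {suc (suc n)} _ C sld = subst (_ ≤_) (sym (size≡weights C))
  (+-mono-≤ (row-bound zero) (row-bound (suc zero)))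
  where
  row-bound : ∀ r → suc ⌊ suc (suc n) /2⌋ ≤ weight (row C r)
  row-bound r = weight-bound (suc n) (row C r) (row-start sld r) (row-guardedRight sld r)
size-bound {suc zero} (s≤s ())

-- A code attaining the bound

-- The clause for two positions makes the last position a codeword also when `n` is even.
alternating : ∀ n → Fin n → Bool
alternating (suc n)             zero          = true
alternating (suc (suc zero))    (suc zero)    = true
alternating (suc (suc (suc n))) (suc zero)    = false
alternating (suc (suc (suc n))) (suc (suc i)) = alternating (suc n) i

weight-alternating : ∀ n → weight (alternating (suc n)) ≡ suc ⌊ suc n /2⌋
weight-alternating zero          = refl
weight-alternating (suc zero)    = refl
weight-alternating (suc (suc n)) = cong suc (weight-alternating n)

alternating-guardedRight : ∀ n → GuardedRight (alternating n)
alternating-guardedRight (suc n) zero i∉ = ⊥-elim (i∉ tt)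
alternating-guardedRight (suc (suc zero)) (suc zero) i∉ = ⊥-elim (i∉ tt)
alternating-guardedRight (suc (suc (suc n))) (suc zero) i∉ = suc (suc zero) , refl , tt
alternating-guardedRight (suc (suc (suc n))) (suc (suc i)) i∉
  with alternating-guardedRight (suc n) i i∉
... | k , e , k∈ = suc (suc k) , cong (2 +_) e , k∈

alternating-guardedLeft : ∀ n → GuardedLeft (alternating n)
alternating-guardedLeft (suc n) zero i∉ = ⊥-elim (i∉ tt)
alternating-guardedLeft (suc (suc zero)) (suc zero) i∉ = ⊥-elim (i∉ tt)
alternating-guardedLeft (suc (suc (suc n))) (suc zero) i∉ = zero , refl , tt
alternating-guardedLeft (suc (suc (suc n))) (suc (suc i)) i∉
  with alternating-guardedLeft (suc n) i i∉
... | j , e , j∈ = suc (suc j) , cong (2 +_) e , j∈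

alternatingColumns : ∀ n → VertexSubset (Ladder n)
alternatingColumns n (i , _) = alternating n i

neighbour-rightward : ∀ {n} {i a : Fin n} {r s} → N[_] (Ladder n) (i , r) (a , s) →
  (suc (toℕ i) ≡ toℕ a × r ≡ s) ⊎ toℕ a ≤ toℕ i
neighbour-rightward (inj₁ refl)                     = inj₂ ≤-refl
neighbour-rightward (inj₂ (inj₁ (refl , _)))        = inj₂ ≤-refl
neighbour-rightward (inj₂ (inj₂ (inj₁ e , r≡s)))    = inj₁ (e , r≡s)
neighbour-rightward (inj₂ (inj₂ (inj₂ e , _)))      = inj₂ (≤-trans (n≤1+n _) (≤-reflexive e))

neighbour-leftward : ∀ {n} {i a : Fin n} {r s} → N[_] (Ladder n) (i , r) (a , s) →
  toℕ i ≤ suc (toℕ a)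
neighbour-leftward (inj₁ refl)                  = n≤1+n _
neighbour-leftward (inj₂ (inj₁ (refl , _)))     = n≤1+n _
neighbour-leftward (inj₂ (inj₂ (inj₁ e , _)))   =
  ≤-trans (n≤1+n _) (≤-trans (≤-reflexive e) (n≤1+n _))
neighbour-leftward (inj₂ (inj₂ (inj₂ e , _)))   = ≤-reflexive (sym e)

-- N[(k , r)] has no vertex left of column `i`, and the only vertex of N[(j , r)] right of column
-- `j` is `(i , r)`.
horizontal-neighbours-locate : ∀ {n} {i j k : Fin n} {r v} →
  suc (toℕ j) ≡ toℕ i → suc (toℕ i) ≡ toℕ k →
  N[_] (Ladder n) (j , r) v → N[_] (Ladder n) (k , r) v → (i , r) ≡ v
horizontal-neighbours-locate ji ik jv kv with neighbour-rightward jv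
... | inj₁ (ja , r≡s) = cong₂ _,_ (toℕ-injective (trans (sym ji) ja)) r≡s
-- Here `k` would be at most `j` + 1, although it equals `j` + 2.
... | inj₂ a≤j = contradiction
  (≤-trans (≤-reflexive (trans (cong suc ji) ik)) (≤-trans (neighbour-leftward kv) (s≤s a≤j)))
  (<-irrefl refl)

alternatingColumns-sld : ∀ n →
  IsSelfLocatingDominating (Ladder (suc n)) (alternatingColumns (suc n))
alternatingColumns-sld n = ((zero , zero) , tt) , locates
  where
  G = Ladder (suc n)
  locates : ∀ u → ¬ T (alternatingColumns (suc n) u) → _
  locates u@(i , r) u∉C
    with alternating-guardedLeft (suc n) i u∉C | alternating-guardedRight (suc n) i u∉C
  ... | j , ji , j∈C | k , ik , k∈C =
    ((j , r) , uj , j∈C) ,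
    (λ {v} v∈⋂ → horizontal-neighbours-locate ji ik
       (v∈⋂ ((j , r) , uj , j∈C)) (v∈⋂ ((k , r) , uk , k∈C))) ,
    -- The reverse inclusion is the symmetry of closed neighbourhoods.
    λ { refl (c , inj₁ u≡c , _) → inj₁ (sym u≡c)
      ; refl (c , inj₂ uc  , _) → inj₂ (adj-sym G {u} {c} uc) }
    where
    uj : N[_] G u (j , r)
    uj = inj₂ (inj₂ (inj₂ ji , refl))
    uk : N[_] G u (k , r)
    uk = inj₂ (inj₂ (inj₁ ik , refl))

-- One formula serves both parities; they are separated only in `double-half`.
γ-ladder : ∀ {n} → 2 ≤ n → γˢˡᵈ[ Ladder n ]≡ (suc ⌊ n /2⌋ + suc ⌊ n /2⌋)
γ-ladder {suc n} 2≤n =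
  (C , alternatingColumns-sld n ,
   trans (size≡weights C) (cong₂ _+_ (weight-alternating n) (weight-alternating n))) ,
  size-bound 2≤n
  where
  C = alternatingColumns (suc n)

double-half : ∀ n →
  (2 ∤ n → suc ⌊ n /2⌋ + suc ⌊ n /2⌋ ≡ n + 1) ×
  (2 ∣ n → suc ⌊ n /2⌋ + suc ⌊ n /2⌋ ≡ n + 2)
double-half zero = (λ 2∤0 → contradiction (2 ∣0) 2∤0) , λ _ → refl
double-half (suc zero) = (λ _ → refl) , λ 2∣1 → contradiction (∣1⇒≡1 2∣1) λ ()
double-half (suc (suc n)) =
  (λ 2∤n → trans step (cong (2 +_) (proj₁ (double-half n) (2∤n ∘ ∣m∣n⇒∣m+n ∣-refl)))) ,
  (λ 2∣n → trans step (cong (2 +_) (proj₂ (double-half n) (∣m+n∣m⇒∣n 2∣n ∣-refl))))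
  where
  h = suc ⌊ n /2⌋
  step : suc h + suc h ≡ 2 + (h + h)
  step = cong suc (+-suc h h)

mainTheorem17 : (n : ℕ) → 2 ≤ n →
    (2 ∤ n → γˢˡᵈ[ P n □ P 2 ]≡ (n + 1)) ×
    (2 ∣ n → γˢˡᵈ[ P n □ P 2 ]≡ (n + 2))
mainTheorem17 n 2≤n =
  (λ 2∤n → subst γˢˡᵈ[ Ladder n ]≡_ (proj₁ (double-half n) 2∤n) (γ-ladder 2≤n)) ,
  (λ 2∣n → subst γˢˡᵈ[ Ladder n ]≡_ (proj₂ (double-half n) 2∣n) (γ-ladder 2≤n))
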